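{- There is no integer $d$ with the following property: for every bipartite graph $G$ with bipartition $(A,B)$ that is $1$-nested on $(A,B)$, there is a half-graph $H$ with the same bipartition $(A,B)$ such that the bipartite local difference between $G$ and $H$ is at most $d$. (Consequently, there is no function $f$ such that for all integers $t\ge 0$, every bipartite graph $G$ that is $t$-nested on its bipartition $(A,B)$ has bipartite local difference at most $f(t)$ from some half-graph with bipartition $(A,B)$.)
   Context: All graphs are finite and have no loops or parallel edges. Let $G$ be a bipartite graph with bipartition $(A,B)$. $G$ is $t$-nested on $(A,B)$ if for all distinct $u,v\in B$, one of $u,v$ has at most $t$ neighbours that are nonadjacent to the other. A half-graph is a bipartite graph with bipartition $(X,Y)$ such that $X,Y$ can be ordered as $X=\{x_1,\ldots,x_m\}$ and $Y=\{y_1,\ldots,y_n\}$ so that for all $1\le i\le i'\le m$ and $1\le j\le j'\le n$, if $x_iy_j$ is an edge then $x_{i'}y_{j'}$ is an edge; equivalently, a bipartite graph that is $0$-nested on $(X,Y)$. If $G,H$ are both bipartite graphs with bipartition $(A,B)$, the bipartite local difference between $G$ and $H$ is the maximum over $v\in B$ of $|N_G(v)\setminus N_H(v)|+|N_H(v)\setminus N_G(v)|$, where $N_G(v),N_H(v)$ are the sets of neighbours of $v$ in $G,H$ (note that the maximum is only over $v\in B$, not $v\in A$). -}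

module Defs where

open import Data.Bool.Base using (Bool; true)
open import Data.Fin.Base using (Fin; _≤_)
open import Data.Fin.Permutation using (Permutation′; _⟨$⟩ʳ_)
open import Data.Fin.Subset using (Subset; _─_; ∣_∣)
open import Data.Integer.Base as ℤ using (ℤ; +_)
open import Data.List.Base using (map; allFin)
open import Data.List.Extrema.Nat using (max)
open import Data.Nat.Base as ℕ using (ℕ; _+_)
open import Data.Product.Base using (∃-syntax; _×_)
open import Data.Sum.Base using (_⊎_)
open import Data.Vec.Base using (tabulate)
open import Relation.Binary.PropositionalEquality.Core using (_≡_; _≢_)

-- Adjacency of a finite simple bipartite graph with bipartition
-- (A , B) = (Fin a , Fin b).  Only pairs in A × B need recording: there are no
-- edges inside A or inside B, and hence no loops; a Boolean per pair excludes
-- parallel edges.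
BipartiteGraph : ℕ → ℕ → Set
BipartiteGraph a b = Fin a → Fin b → Bool

module _ {a b : ℕ} where

  Edge : BipartiteGraph a b → Fin a → Fin b → Set
  Edge G x y = G x y ≡ true

  N : BipartiteGraph a b → Fin b → Subset a
  N G v = tabulate (λ x → G x v)

  -- _─_ is set difference, so N G u ─ N G v consists of the neighbours of u
  -- that are nonadjacent to v.
  Nested : ℕ → BipartiteGraph a b → Set
  Nested t G = ∀ (u v : Fin b) → u ≢ v →
    ∣ N G u ─ N G v ∣ ℕ.≤ t ⊎ ∣ N G v ─ N G u ∣ ℕ.≤ t

  -- An ordering x₁ , … , x_m of A is a permutation σ with xᵢ = σ ⟨$⟩ʳ i,
  -- and similarly for B.
  HalfGraph : BipartiteGraph a b → Set
  HalfGraph H = ∃[ σ ] ∃[ τ ] Ordered σ τ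
    where
    Ordered : Permutation′ a → Permutation′ b → Set
    Ordered σ τ = ∀ (i i′ : Fin a) (j j′ : Fin b) → i ≤ i′ → j ≤ j′ →
      Edge H (σ ⟨$⟩ʳ i) (τ ⟨$⟩ʳ j) → Edge H (σ ⟨$⟩ʳ i′) (τ ⟨$⟩ʳ j′)

  -- The maximum over an empty B is taken to be 0.
  localDifference : BipartiteGraph a b → BipartiteGraph a b → ℕ
  localDifference G H =
    max 0 (map (λ v → ∣ N G v ─ N H v ∣ + ∣ N H v ─ N G v ∣) (allFin b))

NestedNearHalfGraph : ℕ → ℤ → Set
NestedNearHalfGraph t d =
  ∀ {a b : ℕ} (G : BipartiteGraph a b) → Nested t G →
  ∃[ H ] HalfGraph {a} {b} H × + localDifference G H ℤ.≤ d

{-# OPTIONS --safe #-}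
-- Give a complete binary tree of depth d + 1 over a set B of leaves.  Each inner
-- node carries one element of A, adjacent to the leaves of its left subtree, not
-- to those of its right one.  A leaf is adjacent to everything carried by the
-- subtrees to its left and to nothing carried by those to its right, so a leaf
-- loses to a later one only the element at the node where they branch: the graph
-- is 1-nested.  Each node also carries more than 2d padding elements, adjacent
-- only to the leaves of its right subtree; these force any half-graph H within
-- distance d to enlarge neighbourhoods from left to right.  Hence at every node
-- H is wrong about the node's element either on all leaves of the left subtree or
-- on all leaves of the right one.  Descending always to the wrong side reaches a
-- leaf with one error per level.
module Submission where

open import Defs
open import Algebra.Properties.CommutativeSemigroup using (interchange)
open import Data.Bool.Base using (Bool; true; false)
open import Data.Bool.Properties using (_≟_; ¬-not)
open import Data.Fin.Base as Fin using (Fin; zero; _↑ˡ_; _↑ʳ_; splitAt)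
open import Data.Fin.Permutation using (_⟨$⟩ˡ_; inverseʳ)
open import Data.Fin.Properties as Fin using (any?; splitAt-↑ˡ; splitAt-↑ʳ)
open import Data.Fin.Subset using (Subset; _─_; ∣_∣; ⊤; ⊥)
open import Data.Fin.Subset.Properties using (p─⊥≡p; p─⊤≡⊥; ∣⊥∣≡0; ∣⊤∣≡n)
open import Data.Integer.Base as ℤ using (ℤ; +≤+)
open import Data.List.Extrema.Nat using (xs≤max)
open import Data.List.Membership.Propositional.Properties using (∈-allFin)
open import Data.List.Relation.Unary.All as All using ()
open import Data.List.Relation.Unary.All.Properties using (map⁻)
open import Data.Nat.Base using (ℕ; zero; suc; _+_; _≤_; _<_; z≤n; s≤s)
open import Data.Nat.Properties hiding (_≟_)
open import Data.Product.Base using (_×_; Σ-syntax; ∃-syntax; _,_)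
open import Data.Sum.Base as Sum using (_⊎_; inj₁; inj₂; [_,_]′)
open import Data.Vec.Base using ([]; _∷_; _++_; head; tail; take; drop; lookup; tabulate)
open import Data.Vec.Properties using (zipWith-++; ++-injectiveˡ; ++-injectiveʳ; take++drop≡id; tabulate∘lookup)
open import Function.Base using (_∘_)
open import Relation.Binary.PropositionalEquality
open import Relation.Nullary.Decidable.Core using (Dec; yes; no)
open import Relation.Nullary.Negation.Core using (¬_; contradiction)

private
  variable
    a b m n : ℕ

-- Arithmetic of set differences.

∣p++q∣≡∣p∣+∣q∣ : (p : Subset m) (q : Subset n) → ∣ p ++ q ∣ ≡ ∣ p ∣ + ∣ q ∣
∣p++q∣≡∣p∣+∣q∣ []          q = refl
∣p++q∣≡∣p∣+∣q∣ (true  ∷ p) q = cong suc (∣p++q∣≡∣p∣+∣q∣ p q)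
∣p++q∣≡∣p∣+∣q∣ (false ∷ p) q = ∣p++q∣≡∣p∣+∣q∣ p q

dist : Subset n → Subset n → ℕ
dist p q = ∣ p ─ q ∣ + ∣ q ─ p ∣

-- Stated for a general `f` because tree nodes are taken apart under two measures: the one-sided
-- difference, which detects inclusion, and `dist`, which counts errors.
Additive : (∀ {n} → Subset n → Subset n → ℕ) → Set
Additive f = ∀ {m n} (p q : Subset m) (p′ q′ : Subset n) →
  f (p ++ p′) (q ++ q′) ≡ f p q + f p′ q′

∣─∣-additive : Additive (λ p q → ∣ p ─ q ∣)
∣─∣-additive p q p′ q′ =
  trans (cong ∣_∣ (zipWith-++ _ p p′ q q′)) (∣p++q∣≡∣p∣+∣q∣ (p ─ q) (p′ ─ q′))

dist-additive : Additive dist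
dist-additive p q p′ q′ =
  trans (cong₂ _+_ (∣─∣-additive p q p′ q′) (∣─∣-additive q p q′ p′))
        (interchange +-commutativeSemigroup (∣ p ─ q ∣) (∣ p′ ─ q′ ∣) (∣ q ─ p ∣) (∣ q′ ─ p′ ∣))

∣p─⊤∣≡0 : (p : Subset n) → ∣ p ─ ⊤ ∣ ≡ 0
∣p─⊤∣≡0 {n} p = trans (cong ∣_∣ (p─⊤≡⊥ p)) (∣⊥∣≡0 n)

∣⊥─p∣≡0 : (p : Subset n) → ∣ ⊥ ─ p ∣ ≡ 0
∣⊥─p∣≡0 []          = refl
∣⊥─p∣≡0 (true  ∷ p) = ∣⊥─p∣≡0 p
∣⊥─p∣≡0 (false ∷ p) = ∣⊥─p∣≡0 p

∣p─p∣≡0 : (p : Subset n) → ∣ p ─ p ∣ ≡ 0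
∣p─p∣≡0 []          = refl
∣p─p∣≡0 (true  ∷ p) = ∣p─p∣≡0 p
∣p─p∣≡0 (false ∷ p) = ∣p─p∣≡0 p

∣⊤─⊥∣≡n : ∀ n → ∣ ⊤ {n} ─ ⊥ ∣ ≡ n
∣⊤─⊥∣≡n n = trans (cong ∣_∣ (p─⊥≡p {n} ⊤)) (∣⊤∣≡n n)

∣─∣-triangle : (p q r : Subset n) → ∣ p ─ r ∣ ≤ ∣ p ─ q ∣ + ∣ q ─ r ∣
∣─∣-triangle []          []          []          = z≤n
∣─∣-triangle (true  ∷ p) (true  ∷ q) (true  ∷ r) = ∣─∣-triangle p q r
∣─∣-triangle (true  ∷ p) (true  ∷ q) (false ∷ r) =
  ≤-trans (s≤s (∣─∣-triangle p q r)) (≤-reflexive (sym (+-suc _ _)))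
∣─∣-triangle (true  ∷ p) (false ∷ q) (true  ∷ r) = m≤n⇒m≤1+n (∣─∣-triangle p q r)
∣─∣-triangle (true  ∷ p) (false ∷ q) (false ∷ r) = s≤s (∣─∣-triangle p q r)
∣─∣-triangle (false ∷ p) (true  ∷ q) (true  ∷ r) = ∣─∣-triangle p q r
∣─∣-triangle (false ∷ p) (true  ∷ q) (false ∷ r) =
  ≤-trans (∣─∣-triangle p q r) (+-monoʳ-≤ ∣ p ─ q ∣ (n≤1+n _))
∣─∣-triangle (false ∷ p) (false ∷ q) (true  ∷ r) = ∣─∣-triangle p q r
∣─∣-triangle (false ∷ p) (false ∷ q) (false ∷ r) = ∣─∣-triangle p q r

∣tabulate─tabulate∣≡0 : (f g : Fin n → Bool) → (∀ x → f x ≡ true → g x ≡ true) →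
                        ∣ tabulate f ─ tabulate g ∣ ≡ 0
∣tabulate─tabulate∣≡0 {zero}  f g f⊆g = refl
∣tabulate─tabulate∣≡0 {suc n} f g f⊆g with f zero | g zero | f⊆g zero
... | _     | true  | _  = ∣tabulate─tabulate∣≡0 (f ∘ Fin.suc) (g ∘ Fin.suc) (f⊆g ∘ Fin.suc)
... | false | false | _  = ∣tabulate─tabulate∣≡0 (f ∘ Fin.suc) (g ∘ Fin.suc) (f⊆g ∘ Fin.suc)
... | true  | false | h  = contradiction (h refl) λ ()

take-++ : (p : Subset m) (q : Subset n) → take m (p ++ q) ≡ p
take-++ {m} p q = ++-injectiveˡ _ p (take++drop≡id m (p ++ q))

drop-++ : (p : Subset m) (q : Subset n) → drop m (p ++ q) ≡ q
drop-++ {m} p q = ++-injectiveʳ (take m (p ++ q)) p (take++drop≡id m (p ++ q))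

-- Inclusion and chains of neighbourhoods.

head-⊆ : (p q : Subset (suc n)) → head p ≡ true → ∣ p ─ q ∣ ≡ 0 → head q ≡ true
head-⊆ (true ∷ p) (true ∷ q) refl _ = refl

-- Inclusion is expressed as an empty difference, so that additivity and the triangle inequality
-- apply to it directly.
Chain : (Fin b → Subset a) → Set
Chain T = ∀ u v → ∣ T u ─ T v ∣ ≡ 0 ⊎ ∣ T v ─ T u ∣ ≡ 0

-- With the vertex of A held fixed, a half-graph only gains edges as the vertex of B moves up the
-- order. The argument uses nothing else about `H`.
halfGraph⇒chain : (H : BipartiteGraph a b) → HalfGraph H → Chain (N H)
halfGraph⇒chain H (σ , τ , ordered) u v =
  Sum.map (smaller u v) (smaller v u) (Fin.≤-total (τ ⟨$⟩ˡ u) (τ ⟨$⟩ˡ v))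
  where
  smaller : ∀ u v → τ ⟨$⟩ˡ u Fin.≤ τ ⟨$⟩ˡ v → ∣ N H u ─ N H v ∣ ≡ 0
  smaller u v u≤v = ∣tabulate─tabulate∣≡0 _ _ λ x xu →
    subst₂ (Edge H) (inverseʳ σ) (inverseʳ τ)
      (ordered _ _ _ _ ≤-refl u≤v
        (subst₂ (Edge H) (sym (inverseʳ σ {x})) (sym (inverseʳ τ)) xu))

dist≤localDifference : (G H : BipartiteGraph a b) (v : Fin b) →
                       dist (N G v) (N H v) ≤ localDifference G H
dist≤localDifference G H v = All.lookup (map⁻ (xs≤max 0 _)) (∈-allFin v)

-- The tree graph and its nestedness.

module Tree (m : ℕ) where

  -- The elements of a tree are listed as: root, its m padding elements, those of
  -- the left subtree, those of the right subtree.
  size : ℕ → ℕ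
  size zero    = 0
  size (suc k) = suc (m + (size k + size k))

  leaves : ℕ → ℕ
  leaves zero    = 1
  leaves (suc k) = leaves k + leaves k

  toLeft toRight : ∀ {n} → Subset n → Subset (suc (m + (n + n)))
  toLeft  l = true  ∷ ⊥ {m} ++ l ++ ⊥
  toRight r = false ∷ ⊤ {m} ++ ⊤ ++ r

  S : ∀ k → Fin (leaves k) → Subset (size k)
  S zero    _ = []
  S (suc k) v = [ toLeft ∘ S k , toRight ∘ S k ]′ (splitAt (leaves k) v)

  S-↑ˡ : ∀ k v → S (suc k) (v ↑ˡ leaves k) ≡ toLeft (S k v)
  S-↑ˡ k v = cong [ toLeft ∘ S k , toRight ∘ S k ]′ (splitAt-↑ˡ (leaves k) v (leaves k))

  S-↑ʳ : ∀ k v → S (suc k) (leaves k ↑ʳ v) ≡ toRight (S k v)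
  S-↑ʳ k v = cong [ toLeft ∘ S k , toRight ∘ S k ]′ (splitAt-↑ʳ (leaves k) (leaves k) v)

  ∣node─node∣ : ∀ {n} x x′ (c c′ : Subset m) (l l′ r r′ : Subset n) →
    ∣ (x ∷ c ++ l ++ r) ─ (x′ ∷ c′ ++ l′ ++ r′) ∣ ≡
    ∣ (x ∷ []) ─ (x′ ∷ []) ∣ + (∣ c ─ c′ ∣ + (∣ l ─ l′ ∣ + ∣ r ─ r′ ∣))
  ∣node─node∣ x x′ c c′ l l′ r r′
    rewrite ∣─∣-additive (x ∷ []) (x′ ∷ []) (c ++ l ++ r) (c′ ++ l′ ++ r′)
          | ∣─∣-additive c c′ (l ++ r) (l′ ++ r′)
          | ∣─∣-additive l l′ r r′ = refl

  ∣toLeft─toLeft∣ : ∀ {n} (p q : Subset n) → ∣ toLeft p ─ toLeft q ∣ ≡ ∣ p ─ q ∣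
  ∣toLeft─toLeft∣ {n} p q
    rewrite ∣node─node∣ true true ⊥ ⊥ p q ⊥ ⊥
          | ∣p─p∣≡0 (⊥ {m}) | ∣p─p∣≡0 (⊥ {n}) = +-identityʳ _

  ∣toRight─toRight∣ : ∀ {n} (p q : Subset n) → ∣ toRight p ─ toRight q ∣ ≡ ∣ p ─ q ∣
  ∣toRight─toRight∣ {n} p q
    rewrite ∣node─node∣ false false ⊤ ⊤ ⊤ ⊤ p q
          | ∣p─p∣≡0 (⊤ {m}) | ∣p─p∣≡0 (⊤ {n}) = refl

  -- The 1 is the node's own element. In the other blocks either the left leaf has nothing or the
  -- right leaf has everything.
  ∣toLeft─toRight∣ : ∀ {n} (p q : Subset n) → ∣ toLeft p ─ toRight q ∣ ≡ 1
  ∣toLeft─toRight∣ {n} p q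
    rewrite ∣node─node∣ true false ⊥ ⊤ p ⊤ ⊥ q
          | ∣⊥─p∣≡0 (⊤ {m}) | ∣p─⊤∣≡0 p | ∣⊥─p∣≡0 q = refl

  m≤∣toRight─toLeft∣ : ∀ {n} (p q : Subset n) → m ≤ ∣ toRight p ─ toLeft q ∣
  m≤∣toRight─toLeft∣ {n} p q
    rewrite ∣node─node∣ false true ⊤ ⊥ ⊤ q p ⊥ | ∣⊤─⊥∣≡n m = m≤m+n m _

  S-nested : ∀ k u v → ∣ S k u ─ S k v ∣ ≤ 1 ⊎ ∣ S k v ─ S k u ∣ ≤ 1
  S-nested zero    u v = inj₁ z≤n
  S-nested (suc k) u v with splitAt (leaves k) u | splitAt (leaves k) v
  ... | inj₁ u′ | inj₁ v′
    rewrite ∣toLeft─toLeft∣ (S k u′) (S k v′) | ∣toLeft─toLeft∣ (S k v′) (S k u′) = S-nested k u′ v′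
  ... | inj₁ u′ | inj₂ v′ = inj₁ (≤-reflexive (∣toLeft─toRight∣ (S k u′) (S k v′)))
  ... | inj₂ u′ | inj₁ v′ = inj₂ (≤-reflexive (∣toLeft─toRight∣ (S k v′) (S k u′)))
  ... | inj₂ u′ | inj₂ v′
    rewrite ∣toRight─toRight∣ (S k u′) (S k v′) | ∣toRight─toRight∣ (S k v′) (S k u′) = S-nested k u′ v′

  G : ∀ k → BipartiteGraph (size k) (leaves k)
  G k x v = lookup (S k v) x

  N-G : ∀ k v → N (G k) v ≡ S k v
  N-G k v = tabulate∘lookup (S k v)

  G-nested : ∀ k → Nested 1 (G k)
  G-nested k u v _ =
    subst₂ (λ p q → ∣ p ─ q ∣ ≤ 1 ⊎ ∣ q ─ p ∣ ≤ 1) (sym (N-G k u)) (sym (N-G k v)) (S-nested k u v)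

  -- Restriction to the blocks of a node.

  root : ∀ {n} → Subset (suc n) → Subset 1
  root p = head p ∷ []

  leftPart rightPart : ∀ n → Subset (suc (m + (n + n))) → Subset n
  leftPart  n p = take n (drop m (tail p))
  rightPart n p = drop n (drop m (tail p))

  module _ {f : ∀ {n} → Subset n → Subset n → ℕ} (f-additive : Additive f) (n : ℕ) where

    private
      split : ∀ m {n} (p q : Subset (m + n)) →
              f p q ≡ f (take m p) (take m q) + f (drop m p) (drop m q)
      split m p q = trans
        (sym (cong₂ f (take++drop≡id m p) (take++drop≡id m q)))
        (f-additive (take m p) (take m q) (drop m p) (drop m q))

      fRoot fPadding fLeft fRight : (p q : Subset (suc (m + (n + n)))) → ℕ
      fRoot    p q = f (root p) (root q)
      fPadding p q = f (take m (tail p)) (take m (tail q))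
      fLeft    p q = f (leftPart n p) (leftPart n q)
      fRight   p q = f (rightPart n p) (rightPart n q)

      parts : ∀ p q → f p q ≡ fRoot p q + (fPadding p q + (fLeft p q + fRight p q))
      parts p@(x ∷ p′) q@(y ∷ q′) = trans (f-additive (root p) (root q) p′ q′)
        (cong (fRoot p q +_) (trans (split m p′ q′)
          (cong (fPadding p q +_) (split n (drop m p′) (drop m q′)))))

    root+left≤ : ∀ p q → f (root p) (root q) + f (leftPart n p) (leftPart n q) ≤ f p q
    root+left≤ p q rewrite parts p q = +-monoʳ-≤ (fRoot p q)
      (m≤n⇒m≤o+n (fPadding p q) (m≤m+n (fLeft p q) (fRight p q)))

    root+right≤ : ∀ p q → f (root p) (root q) + f (rightPart n p) (rightPart n q) ≤ f p q
    root+right≤ p q rewrite parts p q = +-monoʳ-≤ (fRoot p q)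
      (m≤n⇒m≤o+n (fPadding p q) (m≤n+m (fRight p q) (fLeft p q)))

  leftPart-toLeft : ∀ {n} (p : Subset n) → leftPart n (toLeft p) ≡ p
  leftPart-toLeft {n} p rewrite drop-++ (⊥ {m}) (p ++ ⊥ {n}) = take-++ p ⊥

  rightPart-toRight : ∀ {n} (p : Subset n) → rightPart n (toRight p) ≡ p
  rightPart-toRight {n} p rewrite drop-++ (⊤ {m}) (⊤ {n} ++ p) = drop-++ (⊤ {n}) p

  -- Serves twice in the descent: it keeps the restriction to the subtree within `d`, and it adds
  -- the error at the root to the errors found below. Errors in the padding and in the other subtree
  -- are discarded.
  toLeft-dist : ∀ {n} (p : Subset n) q →
    dist (true ∷ []) (root q) + dist p (leftPart n q) ≤ dist (toLeft p) q
  toLeft-dist {n} p q =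
    subst (λ l → dist (true ∷ []) (root q) + dist l (leftPart n q) ≤ dist (toLeft p) q)
          (leftPart-toLeft p) (root+left≤ {dist} dist-additive n (toLeft p) q)

  toRight-dist : ∀ {n} (p : Subset n) q →
    dist (false ∷ []) (root q) + dist p (rightPart n q) ≤ dist (toRight p) q
  toRight-dist {n} p q =
    subst (λ r → dist (false ∷ []) (root q) + dist r (rightPart n q) ≤ dist (toRight p) q)
          (rightPart-toRight p) (root+right≤ {dist} dist-additive n (toRight p) q)

  -- By additivity the difference on a block is at most the whole difference, so an inclusion passes
  -- to the block.
  leftPart-chain : ∀ n (T : Fin b → Subset (suc (m + (n + n)))) → Chain T → Chain (leftPart n ∘ T)
  leftPart-chain n T chain u v = Sum.map (shrink (T u) (T v)) (shrink (T v) (T u)) (chain u v)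
    where
    shrink : ∀ p q → ∣ p ─ q ∣ ≡ 0 → ∣ leftPart n p ─ leftPart n q ∣ ≡ 0
    shrink p q p⊆q = n≤0⇒n≡0 (subst (∣ leftPart n p ─ leftPart n q ∣ ≤_) p⊆q
      (m+n≤o⇒n≤o (∣ root p ─ root q ∣) (root+left≤ {λ r s → ∣ r ─ s ∣} ∣─∣-additive n p q)))

  rightPart-chain : ∀ n (T : Fin b → Subset (suc (m + (n + n)))) → Chain T → Chain (rightPart n ∘ T)
  rightPart-chain n T chain u v = Sum.map (shrink (T u) (T v)) (shrink (T v) (T u)) (chain u v)
    where
    shrink : ∀ p q → ∣ p ─ q ∣ ≡ 0 → ∣ rightPart n p ─ rightPart n q ∣ ≡ 0
    shrink p q p⊆q = n≤0⇒n≡0 (subst (∣ rightPart n p ─ rightPart n q ∣ ≤_) p⊆q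
      (m+n≤o⇒n≤o (∣ root p ─ root q ∣) (root+right≤ {λ r s → ∣ r ─ s ∣} ∣─∣-additive n p q)))

  -- Forcing one error per level.

  module _ {d : ℕ} (2d<m : d + d < m) where

    -- Such an inclusion would require all `m` padding elements to be accounted for by errors, and
    -- the two leaves have at most `d` each.
    ¬toRight-below-toLeft : ∀ {n} (p q : Subset n) p′ q′ →
      dist (toRight p) p′ ≤ d → dist (toLeft q) q′ ≤ d → ∣ p′ ─ q′ ∣ ≢ 0
    ¬toRight-below-toLeft p q p′ q′ p≈p′ q≈q′ p′⊆q′ = <⇒≱ 2d<m (begin
      m                                            ≤⟨ m≤∣toRight─toLeft∣ p q ⟩
      ∣ toRight p ─ toLeft q ∣                     ≤⟨ ∣─∣-triangle (toRight p) p′ (toLeft q) ⟩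
      ∣ toRight p ─ p′ ∣ + ∣ p′ ─ toLeft q ∣       ≤⟨ +-mono-≤ (m+n≤o⇒m≤o _ p≈p′) (∣─∣-triangle p′ q′ (toLeft q)) ⟩
      d + (∣ p′ ─ q′ ∣ + ∣ q′ ─ toLeft q ∣)        ≡⟨ cong (λ z → d + (z + ∣ q′ ─ toLeft q ∣)) p′⊆q′ ⟩
      d + ∣ q′ ─ toLeft q ∣                        ≤⟨ +-monoʳ-≤ d (m+n≤o⇒n≤o (∣ toLeft q ─ q′ ∣) q≈q′) ⟩
      d + d                                        ∎)
      where open ≤-Reasoning

    -- Induction on the depth. The bound `d` stays the same at every level, so the padding of each
    -- node remains large enough to force the order there.
    farLeaf : ∀ k (T : Fin (leaves k) → Subset (size k)) → Chain T →
              (∀ v → dist (S k v) (T v) ≤ d) → ∃[ v ] k ≤ dist (S k v) (T v)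
    farLeaf zero    T chain near = zero , z≤n
    farLeaf (suc k) T chain near = step (any? λ u → head (Tˡ u) ≟ true)
      where
      Tˡ Tʳ : Fin (leaves k) → Subset (size (suc k))
      Tˡ u = T (u ↑ˡ leaves k)
      Tʳ u = T (leaves k ↑ʳ u)

      nearˡ : ∀ u → dist (toLeft (S k u)) (Tˡ u) ≤ d
      nearˡ u = subst (λ p → dist p (Tˡ u) ≤ d) (S-↑ˡ k u) (near _)

      nearʳ : ∀ u → dist (toRight (S k u)) (Tʳ u) ≤ d
      nearʳ u = subst (λ p → dist p (Tʳ u) ≤ d) (S-↑ʳ k u) (near _)

      Goal : Set
      Goal = ∃[ v ] suc k ≤ dist (S (suc k) v) (T v)

      descendˡ : (∀ u → head (Tˡ u) ≡ false) → Goal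
      descendˡ wrong with farLeaf k (leftPart (size k) ∘ Tˡ)
        (leftPart-chain (size k) Tˡ λ u v → chain (u ↑ˡ leaves k) (v ↑ˡ leaves k))
        (λ u → m+n≤o⇒n≤o (dist (true ∷ []) (root (Tˡ u))) (≤-trans (toLeft-dist (S k u) (Tˡ u)) (nearˡ u)))
      ... | v , k≤ = v ↑ˡ leaves k , subst (λ p → suc k ≤ dist p (Tˡ v)) (sym (S-↑ˡ k v))
        -- The left side of the `cong` equation computes to 1, the new error at the root.
        (≤-trans (+-mono-≤ (≤-reflexive (cong (λ x → dist (true ∷ []) (x ∷ [])) (sym (wrong v)))) k≤)
                 (toLeft-dist (S k v) (Tˡ v)))

      descendʳ : (∀ u → head (Tʳ u) ≡ true) → Goal
      descendʳ wrong with farLeaf k (rightPart (size k) ∘ Tʳ)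
        (rightPart-chain (size k) Tʳ λ u v → chain (leaves k ↑ʳ u) (leaves k ↑ʳ v))
        (λ u → m+n≤o⇒n≤o (dist (false ∷ []) (root (Tʳ u))) (≤-trans (toRight-dist (S k u) (Tʳ u)) (nearʳ u)))
      ... | v , k≤ = leaves k ↑ʳ v , subst (λ p → suc k ≤ dist p (Tʳ v)) (sym (S-↑ʳ k v))
        (≤-trans (+-mono-≤ (≤-reflexive (cong (λ x → dist (false ∷ []) (x ∷ [])) (sym (wrong v)))) k≤)
                 (toRight-dist (S k v) (Tʳ v)))

      step : Dec (∃[ u ] head (Tˡ u) ≡ true) → Goal
      step (no ¬∃)           = descendˡ λ u → ¬-not (¬∃ ∘ (u ,_))
      -- One left leaf with the root element suffices: by the padding its set lies inside that of
      -- every right leaf, so all right leaves wrongly contain the element.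
      step (yes (u , root∈)) = descendʳ λ v →
        [ head-⊆ (Tˡ u) (Tʳ v) root∈
        , (λ ⊆0 → contradiction ⊆0
            (¬toRight-below-toLeft (S k v) (S k u) (Tʳ v) (Tˡ u) (nearʳ v) (nearˡ u)))
        ]′ (chain (u ↑ˡ leaves k) (leaves k ↑ʳ v))

-- Choice of parameters.

+m≤i⇒m≤∣i∣ : ∀ {i} → ℤ.+ m ℤ.≤ i → m ≤ ℤ.∣ i ∣
+m≤i⇒m≤∣i∣ (+≤+ m≤n) = m≤n

¬nestedNearHalfGraph-1 : ∀ d → ¬ NestedNearHalfGraph 1 d
¬nestedNearHalfGraph-1 d near = far (near (G k) (G-nested k))
  where
  -- The absolute value makes the bound a natural number even for negative `d`. Padding
  -- `suc (D + D)` just exceeds twice `D`, and depth `suc D` yields one error too many.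
  D = ℤ.∣ d ∣
  open Tree (suc (D + D))
  k = suc D

  far : ¬ (∃[ H ] HalfGraph H × ℤ.+ localDifference (G k) H ℤ.≤ d)
  far (H , half , close) =
    let v , k≤ = farLeaf ≤-refl k (N H) (halfGraph⇒chain H half) H-near in <⇒≱ k≤ (H-near v)
    where
    H-near : ∀ v → dist (S k v) (N H v) ≤ D
    H-near v = subst (λ p → dist p (N H v) ≤ D) (N-G k v)
      (≤-trans (dist≤localDifference (G k) H v) (+m≤i⇒m≤∣i∣ close))

mainTheorem2 : (¬ (Σ[ d ∈ ℤ ] NestedNearHalfGraph 1 d))
    × (¬ (Σ[ f ∈ (ℕ → ℤ) ] ((t : ℕ) → NestedNearHalfGraph t (f t))))
mainTheorem2 = (λ (d , near) → ¬nestedNearHalfGraph-1 d near)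
             , (λ (f , near) → ¬nestedNearHalfGraph-1 (f 1) (near 1))
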